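{- Let $g\in\mathbb{N}$, $g\geq 1$, be fixed. For each $n\in\mathbb{N}$, let $\vec{Z}_n$ be an acyclic orientation of the $n$-th Zykov graph $Z_n$ such that there is at most one directed path between any two of its vertices. Then: (1) for every $n$, the graph $L^g(\vec{Z}_n)$ can be acyclically oriented such that between any two vertices there exists at most one directed path; (2) $\chi(L^g(\vec{Z}_n))\to\infty$ as $n\to\infty$; (3) for every $n$, the graph $L^g(\vec{Z}_n)$ has odd-girth greater than or equal to $2g+3$.
   Context: All graphs are finite and simple; digraphs are orientations of simple graphs. "At most one directed path between any two vertices" means: for all distinct vertices $u,v$ there is at most one directed path from $u$ to $v$. A digraph is acyclic if it has no directed cycle. The line digraph $\vec{L}(\vec{G})$ of a digraph $\vec{G}$ has as vertices the arcs of $\vec{G}$, with an arc from $ab$ to $cd$ iff $b=c$. If $\vec{G}$ is acyclic then so is $\vec{L}(\vec{G})$, and one defines iterated line digraphs $\vec{L}^0(\vec{G})=\vec{G}$, $\vec{L}^g(\vec{G})=\vec{L}(\vec{L}^{g-1}(\vec{G}))$ for $g\geq 1$; $L^g(\vec{G})$ denotes the underlying undirected graph of $\vec{L}^g(\vec{G})$. Zykov graphs: $Z_1$ is a single vertex; for $n\geq 1$, $Z_{n+1}$ is obtained from the disjoint union of $Z_1,\dots,Z_n$ by adding, for each tuple $(x_1,\dots,x_n)\in V(Z_1)\times\cdots\times V(Z_n)$, a new vertex adjacent exactly to $x_1,\dots,x_n$. It is known that each $Z_n$ admits an acyclic orientation with at most one directed path between any two vertices. $\chi$ is the chromatic number.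 The odd-girth of a graph is the number of edges in a shortest odd cycle; a graph with no odd cycle is regarded as having infinite odd-girth. -}

module Defs where

open import Data.Empty using (⊥; ⊥-elim)
open import Data.Fin.Base using (Fin)
import Data.Fin.Properties as Fin
open import Data.List.Base
  using (List; []; _∷_; foldr; map; _++_; cartesianProduct; length; lookup; head; last; allFin)
open import Data.List.Membership.Propositional using (_∈_; lose)
open import Data.List.Membership.Propositional.Properties
  using (∈-++⁺ˡ; ∈-++⁺ʳ; ∈-map⁺; ∈-cartesianProduct⁺; ∈-allFin; ∈-lookup)
open import Data.List.Membership.Setoid.Properties using (index-injective)
open import Data.List.Relation.Unary.All using (all?)
import Data.List.Relation.Unary.All as All
open import Data.List.Relation.Unary.Any using (any?; index; here; there; satisfied)
open import Data.List.Relation.Unary.Any.Properties using (lookup-index)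
open import Data.List.Relation.Unary.AllPairs using ([]; _∷_)
open import Data.List.Relation.Unary.Linked using (Linked; linked?)
open import Data.List.Relation.Unary.Unique.Propositional using (Unique)
open import Data.List.Relation.Unary.Unique.DecPropositional using (unique?)
import Data.Maybe.Properties as Maybe
open import Data.Maybe.Base using (just)
open import Data.Nat.Base using (ℕ; zero; suc; _≤_; _<_; _≥_; s≤s)
open import Data.Nat.Divisibility using (_∤_; _∣?_)
open import Data.Nat.Properties using (_≤?_; ≤-refl; ≮⇒≥; m<1+n⇒m<n∨m≡n) renaming (_≟_ to _≟ℕ_)
open import Data.Bool.Properties using (T-irrelevant)
open import Data.Product.Base using (Σ-syntax; ∃; ∃₂; _×_; _,_; proj₁; proj₂)
import Data.Product.Properties as Product
open import Data.Sum.Base using (_⊎_; inj₁; inj₂; swap)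
import Data.Sum.Properties as Sum
open import Data.Unit.Base using (⊤; tt)
open import Data.Vec.Base using (Vec; []; _∷_; toList; fromList; tabulate)
import Data.Vec.Base as Vec
open import Data.Vec.Properties using (lookup∘tabulate; toList∘fromList)
open import Function.Base using (_∘_)
open import Level using (0ℓ)
open import Relation.Binary.Core using (Rel)
open import Relation.Binary.Construct.Add.Supremum.NonStrict _≤_ public using (_≤⁺_)
open import Relation.Binary.Definitions
  using (DecidableEquality; Symmetric; Irreflexive; Asymmetric)
  renaming (Decidable to Decidable₂)
open import Relation.Binary.PropositionalEquality as ≡
  using (_≡_; _≢_; refl; trans; cong; subst; setoid)
open import Relation.Nullary.Construct.Add.Supremum public using (_⁺; ⊤⁺; [_])
open import Relation.Nullary.Decidable
  using (Dec; yes; no; True; isYes; T?; toWitness; map′; _×-dec_; _⊎-dec_; _→-dec_; ¬?)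
open import Relation.Nullary.Negation using (¬_; contradiction)
open import Relation.Unary using (Pred; Decidable)

------------------------------------------------------------------------
-- Finite types

record Finite (A : Set) : Set where
  field
    _≟_      : DecidableEquality A
    elements : List A
    complete : ∀ x → x ∈ elements

  any-dec : {P : Pred A 0ℓ} → Decidable P → Dec (∃ P)
  any-dec {P} P? = map′ satisfied (λ (x , px) → lose (complete x) px) (any? P? elements)

  all-dec : {P : Pred A 0ℓ} → Decidable P → Dec (∀ x → P x)
  all-dec P? = map′ (λ ps x → All.lookup ps (complete x)) (λ f → All.tabulate (λ {x} _ → f x))
                    (all? P? elements)

  any-vec-dec : ∀ n {P : Pred (Vec A n) 0ℓ} → Decidable P → Dec (∃ P)
  any-vec-dec zero    P? = map′ ([] ,_) (λ { ([] , p) → p }) (P? [])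
  any-vec-dec (suc n) P? =
    map′ (λ (x , xs , p) → (x ∷ xs) , p) (λ { ((x ∷ xs) , p) → x , xs , p })
         (any-dec λ x → any-vec-dec n λ xs → P? (x ∷ xs))

  position : A → Fin (length elements)
  position x = index (complete x)

  position-injective : ∀ {x y} → position x ≡ position y → x ≡ y
  position-injective = index-injective (setoid A) (complete _) (complete _)

finite-⊥ : Finite ⊥
finite-⊥ = record { _≟_ = λ () ; elements = [] ; complete = λ () }

finite-⊤ : Finite ⊤
finite-⊤ = record { _≟_ = λ _ _ → yes refl ; elements = tt ∷ [] ; complete = λ _ → here refl }

finite-Fin : ∀ n → Finite (Fin n)
finite-Fin n = record { _≟_ = Fin._≟_ ; elements = allFin n ; complete = ∈-allFin }

finite-⊎ : ∀ {A B} → Finite A → Finite B → Finite (A ⊎ B)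
finite-⊎ A B = record
  { _≟_      = Sum.≡-dec A._≟_ B._≟_
  ; elements = map inj₁ A.elements ++ map inj₂ B.elements
  ; complete = λ { (inj₁ x) → ∈-++⁺ˡ (∈-map⁺ inj₁ (A.complete x))
                 ; (inj₂ y) → ∈-++⁺ʳ (map inj₁ A.elements) (∈-map⁺ inj₂ (B.complete y)) }
  }
  where module A = Finite A; module B = Finite B

finite-× : ∀ {A B} → Finite A → Finite B → Finite (A × B)
finite-× A B = record
  { _≟_      = Product.≡-dec A._≟_ B._≟_
  ; elements = cartesianProduct A.elements B.elements
  ; complete = λ (x , y) → ∈-cartesianProduct⁺ (A.complete x) (B.complete y)
  }
  where module A = Finite A; module B = Finite B

module _ {A : Set} {P : Pred A 0ℓ} (P? : Decidable P) where

  private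
    S : Set
    S = Σ[ x ∈ A ] True (P? x)

    select : List A → List S
    select []       = []
    select (x ∷ xs) with T? (isYes (P? x))
    ... | yes t = (x , t) ∷ select xs
    ... | no  _ = select xs

    ∈-select : ∀ {x xs} (t : True (P? x)) → x ∈ xs → (x , t) ∈ select xs
    ∈-select {xs = y ∷ _} t x∈ with T? (isYes (P? y))
    ∈-select t (here refl) | yes _ = here (cong (_ ,_) (T-irrelevant _ _))
    ∈-select t (there x∈)  | yes _ = there (∈-select t x∈)
    ∈-select t (here refl) | no ¬t = contradiction t ¬t
    ∈-select t (there x∈)  | no _  = ∈-select t x∈

  finite-True : Finite A → Finite (Σ[ x ∈ A ] True (P? x))
  finite-True A = record
    { _≟_      = Product.≡-dec A._≟_ (λ _ _ → yes (T-irrelevant _ _))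
    ; elements = select A.elements
    ; complete = λ (x , t) → ∈-select t (A.complete x)
    }
    where module A = Finite A

------------------------------------------------------------------------
-- Graphs, digraphs and orientations

record Graph : Set₁ where
  field
    V      : Set
    finite : Finite V
    Adj    : Rel V 0ℓ
    adj?   : Decidable₂ Adj
    sym    : Symmetric Adj
    irrefl : Irreflexive _≡_ Adj

-- Asymmetry excludes loops and antiparallel arcs, so a digraph is an
-- orientation of a simple graph.
record Digraph : Set₁ where
  field
    V      : Set
    finite : Finite V
    Arc    : Rel V 0ℓ
    arc?   : Decidable₂ Arc
    asym   : Asymmetric Arc

underlying : Digraph → Graph
underlying D = record
  { V      = V
  ; finite = finite
  ; Adj    = λ u v → Arc u v ⊎ Arc v u
  ; adj?   = λ u v → arc? u v ⊎-dec arc? v u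
  ; sym    = swap
  ; irrefl = λ { refl (inj₁ a) → asym a a ; refl (inj₂ a) → asym a a }
  }
  where open Digraph D

record Orientation (G : Graph) : Set₁ where
  open Graph G
  field
    Arc     : Rel V 0ℓ
    asym    : Asymmetric Arc
    Arc⇒Adj : ∀ {u v} → Arc u v → Adj u v
    Adj⇒Arc : ∀ {u v} → Adj u v → Arc u v ⊎ Arc v u

  arc? : Decidable₂ Arc
  arc? u v with adj? u v
  ... | no ¬adj = no (¬adj ∘ Arc⇒Adj)
  ... | yes adj with Adj⇒Arc adj
  ...   | inj₁ uv = yes uv
  ...   | inj₂ vu = no (asym vu)

digraph : ∀ {G} → Orientation G → Digraph
digraph {G} O = record { V = V ; finite = finite ; Arc = Arc ; arc? = arc? ; asym = asym }
  where open Graph G using (V; finite); open Orientation O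

------------------------------------------------------------------------
-- Paths and cycles, given by their sequences of vertices

IsPath : {A : Set} → Rel A 0ℓ → A → A → List A → Set
IsPath R u v p = head p ≡ just u × last p ≡ just v × Linked R p × Unique p

-- The closing edge from the last vertex to the first is implicit, so the
-- number of edges is the length of the list.
IsClosedPath : {A : Set} → Rel A 0ℓ → List A → Set
IsClosedPath R c = ∃₂ λ u v → IsPath R u v c × R v u

Acyclic : Digraph → Set
Acyclic D = ∀ c → ¬ IsClosedPath Arc c
  where open Digraph D

AtMostOneDirectedPath : Digraph → Set
AtMostOneDirectedPath D =
  ∀ {u v} → u ≢ v → ∀ {p q} → IsPath Arc u v p → IsPath Arc u v q → p ≡ q
  where open Digraph D

IsCycle : (G : Graph) → List (Graph.V G) → Set
IsCycle G c = IsClosedPath Adj c × 3 ≤ length c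
  where open Graph G

------------------------------------------------------------------------
-- Line digraphs

-- An arc is a pair of vertices together with a proof-irrelevant witness, so
-- that each arc of D is exactly one vertex of the line digraph.
lineDigraph : Digraph → Digraph
lineDigraph D = record
  { V      = Σ[ (a , b) ∈ V × V ] True (arc? a b)
  ; finite = finite-True (λ (a , b) → arc? a b) (finite-× finite finite)
  ; Arc    = λ ((a , b) , _) ((c , d) , _) → b ≡ c
  ; arc?   = λ ((_ , b) , _) ((c , _) , _) → b ≟ c
  ; asym   = λ { {(a , b) , ab} {(_ , _) , ba} refl refl → asym (toWitness ab) (toWitness ba) }
  }
  where open Digraph D; open Finite finite

L⃗^ : ℕ → Digraph → Digraph
L⃗^ zero    D = D
L⃗^ (suc g) D = lineDigraph (L⃗^ g D)

L^ : ℕ → Digraph → Graph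
L^ g D = underlying (L⃗^ g D)

------------------------------------------------------------------------
-- Zykov graphs

emptyGraph : Graph
emptyGraph = record
  { V = ⊥ ; finite = finite-⊥ ; Adj = λ () ; adj? = λ ()
  ; sym = λ {x} → ⊥-elim x ; irrefl = λ {x} → ⊥-elim x
  }

module _ (G H : Graph) where
  private
    module G = Graph G
    module H = Graph H

  data UnionAdj : Rel (G.V ⊎ H.V) 0ℓ where
    left  : ∀ {x y} → G.Adj x y → UnionAdj (inj₁ x) (inj₁ y)
    right : ∀ {x y} → H.Adj x y → UnionAdj (inj₂ x) (inj₂ y)

  disjointUnion : Graph
  disjointUnion = record
    { V      = G.V ⊎ H.V
    ; finite = finite-⊎ G.finite H.finite
    ; Adj    = UnionAdj
    ; adj?   = λ { (inj₁ x) (inj₁ y) → map′ left (λ { (left a) → a }) (G.adj? x y)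
                 ; (inj₁ x) (inj₂ y) → no λ ()
                 ; (inj₂ x) (inj₁ y) → no λ ()
                 ; (inj₂ x) (inj₂ y) → map′ right (λ { (right a) → a }) (H.adj? x y) }
    ; sym    = λ { (left a) → left (G.sym a) ; (right a) → right (H.sym a) }
    ; irrefl = λ { refl (left a) → G.irrefl refl a ; refl (right a) → H.irrefl refl a }
    }

⨄ : List Graph → Graph
⨄ = foldr disjointUnion emptyGraph

Tuple : List Graph → Set
Tuple []       = ⊤
Tuple (G ∷ Gs) = Graph.V G × Tuple Gs

finite-Tuple : ∀ Gs → Finite (Tuple Gs)
finite-Tuple []       = finite-⊤
finite-Tuple (G ∷ Gs) = finite-× (Graph.finite G) (finite-Tuple Gs)

IsComponent : ∀ Gs → Graph.V (⨄ Gs) → Tuple Gs → Set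
IsComponent (G ∷ Gs) (inj₁ x) (y , _) = x ≡ y
IsComponent (G ∷ Gs) (inj₂ x) (_ , t) = IsComponent Gs x t

isComponent? : ∀ Gs → Decidable₂ (IsComponent Gs)
isComponent? (G ∷ Gs) (inj₁ x) (y , _) = Finite._≟_ (Graph.finite G) x y
isComponent? (G ∷ Gs) (inj₂ x) (_ , t) = isComponent? Gs x t

module _ (Gs : List Graph) where
  private module U = Graph (⨄ Gs)

  data ZykovAdj : Rel (U.V ⊎ Tuple Gs) 0ℓ where
    old     : ∀ {x y} → U.Adj x y → ZykovAdj (inj₁ x) (inj₁ y)
    old-new : ∀ {x t} → IsComponent Gs x t → ZykovAdj (inj₁ x) (inj₂ t)
    new-old : ∀ {x t} → IsComponent Gs x t → ZykovAdj (inj₂ t) (inj₁ x)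

  zykovStep : Graph
  zykovStep = record
    { V      = U.V ⊎ Tuple Gs
    ; finite = finite-⊎ U.finite (finite-Tuple Gs)
    ; Adj    = ZykovAdj
    ; adj?   = λ { (inj₁ x) (inj₁ y) → map′ old (λ { (old a) → a }) (U.adj? x y)
                 ; (inj₁ x) (inj₂ t) → map′ old-new (λ { (old-new c) → c }) (isComponent? Gs x t)
                 ; (inj₂ t) (inj₁ x) → map′ new-old (λ { (new-old c) → c }) (isComponent? Gs x t)
                 ; (inj₂ _) (inj₂ _) → no λ () }
    ; sym    = λ { (old a) → old (U.sym a) ; (old-new c) → new-old c ; (new-old c) → old-new c }
    ; irrefl = λ { refl (old a) → U.irrefl refl a }
    }

-- zykovs n lists Z_n, …, Z_1.  For the empty list there is exactly one
-- (empty) tuple, so Z_1 is a single vertex.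
zykovs : ℕ → List Graph
zykovs zero    = []
zykovs (suc n) = zykovStep (zykovs n) ∷ zykovs n

Z[1+_] : ℕ → Graph
Z[1+ n ] = zykovStep (zykovs n)

------------------------------------------------------------------------
-- Minima

IsLeast : Pred ℕ 0ℓ → Pred ℕ 0ℓ
IsLeast P m = P m × (∀ {j} → P j → m ≤ j)

search : ∀ {P} → Decidable P → ∀ n → ∃ (IsLeast P) ⊎ (∀ {j} → j < n → ¬ P j)
search P? zero    = inj₂ λ ()
search P? (suc n) with search P? n
... | inj₁ l    = inj₁ l
... | inj₂ none with P? n
...   | yes pn = inj₁ (n , pn , λ pj → ≮⇒≥ λ j<n → none j<n pj)
...   | no ¬pn = inj₂ λ j<1+n pj → case (m<1+n⇒m<n∨m≡n j<1+n) pj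
  where
  case : ∀ {j} → j < n ⊎ j ≡ n → ¬ _
  case (inj₁ j<n)  pj = none j<n pj
  case (inj₂ refl) pj = ¬pn pj

------------------------------------------------------------------------
-- Chromatic number

module _ (G : Graph) where
  open Graph G
  open Finite finite

  Colourable : Pred ℕ 0ℓ
  Colourable k = Σ[ c ∈ (V → Fin k) ] (∀ {u v} → Adj u v → c u ≢ c v)

  colourable? : Decidable Colourable
  colourable? k = map′ to from (Finite.any-vec-dec (finite-Fin k) (length elements) λ w →
      all-dec λ u → all-dec λ v → adj? u v →-dec ¬? (colour w u Fin.≟ colour w v))
    where
    colour : Vec (Fin k) (length elements) → V → Fin k
    colour w v = Vec.lookup w (position v)

    to : ∃ (λ w → ∀ u v → Adj u v → colour w u ≢ colour w v) → Colourable k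
    to (w , proper) = colour w , λ {u} {v} → proper u v

    from : Colourable k → ∃ (λ w → ∀ u v → Adj u v → colour w u ≢ colour w v)
    from (c , proper) = w , λ u v a e → proper a (trans (≡.sym (w-spec u)) (trans e (w-spec v)))
      where
      w = tabulate (c ∘ lookup elements)
      w-spec : ∀ v → colour w v ≡ c v
      w-spec v = trans (lookup∘tabulate _ (position v)) (cong c (≡.sym (lookup-index (complete v))))

  chromaticNumber : ∃ (IsLeast Colourable)
  chromaticNumber with search colourable? (suc (length elements))
  ... | inj₁ l    = l
  ... | inj₂ none =
    ⊥-elim (none ≤-refl (position , λ a e → irrefl (position-injective e) a))

  χ : ℕ
  χ = proj₁ chromaticNumber

------------------------------------------------------------------------
-- Odd-girth

module _ {A : Set} where

  Unique⇒lookup-injective : {xs : List A} → Unique xs → ∀ {i j} → lookup xs i ≡ lookup xs j → i ≡ j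
  Unique⇒lookup-injective (_ ∷ _)  {Fin.zero}  {Fin.zero}  _ = refl
  Unique⇒lookup-injective (x ∷ _)  {Fin.zero}  {Fin.suc j} e = contradiction e (All.lookup x (∈-lookup j))
  Unique⇒lookup-injective (x ∷ _)  {Fin.suc i} {Fin.zero}  e = contradiction (≡.sym e) (All.lookup x (∈-lookup i))
  Unique⇒lookup-injective (_ ∷ xs) {Fin.suc i} {Fin.suc j} e = cong Fin.suc (Unique⇒lookup-injective xs e)

module _ (G : Graph) where
  open Graph G
  open Finite finite

  IsOddCycle : List V → Set
  IsOddCycle c = IsCycle G c × 2 ∤ length c

  OddCycleOfLength : Pred ℕ 0ℓ
  OddCycleOfLength m = ∃ λ c → IsOddCycle c × length c ≡ m

  IsOddGirth : ℕ ⁺ → Set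
  IsOddGirth [ m ] = IsLeast OddCycleOfLength m
  IsOddGirth ⊤⁺    = ∀ c → ¬ IsOddCycle c

  isOddCycle? : Decidable IsOddCycle
  isOddCycle? c =
    ((any-dec λ u → any-dec λ v →
       (Maybe.≡-dec _≟_ (head c) (just u) ×-dec Maybe.≡-dec _≟_ (last c) (just v)
         ×-dec linked? adj? c ×-dec unique? _≟_ c)
       ×-dec adj? v u)
     ×-dec 3 ≤? length c)
    ×-dec ¬? (2 ∣? length c)

  oddCycleOfLength? : Decidable OddCycleOfLength
  oddCycleOfLength? m = map′ to from
    (any-vec-dec m λ w → isOddCycle? (toList w) ×-dec (length (toList w) ≟ℕ m))
    where
    W : Vec V m → Set
    W w = IsOddCycle (toList w) × length (toList w) ≡ m

    to : ∃ W → OddCycleOfLength m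
    to (w , p) = toList w , p

    from : OddCycleOfLength m → ∃ W
    from (c , odd , refl) = fromList c ,
      subst (λ d → IsOddCycle d × length d ≡ m) (≡.sym (toList∘fromList c)) (odd , refl)

  oddCycle-bounded : ∀ {c} → IsOddCycle c → length c < suc (length elements)
  oddCycle-bounded (((_ , _ , (_ , _ , _ , unique) , _) , _) , _) =
    s≤s (Fin.injective⇒≤ (Unique⇒lookup-injective unique ∘ position-injective))

  oddGirthExists : ∃ IsOddGirth
  oddGirthExists with search oddCycleOfLength? (suc (length elements))
  ... | inj₁ (m , least) = [ m ] , least
  ... | inj₂ none        = ⊤⁺ , λ c odd → none (oddCycle-bounded odd) (c , odd , refl)

  oddGirth : ℕ ⁺
  oddGirth = proj₁ oddGirthExists

------------------------------------------------------------------------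

TendsToInfinity : (ℕ → ℕ) → Set
TendsToInfinity f = ∀ k → ∃ λ N → ∀ n → n ≥ N → f n ≥ k

{-# OPTIONS --safe #-}
module Submission where

-- A directed walk in L⃗(D) traces a directed walk in D that is one arc longer
-- and determines it, so the natural orientation of L^g proves (1).
-- A k-colouring of L(D) yields a 2^k-colouring of D: colour a vertex by the set
-- of colours of its outgoing arcs.  As χ(Zₙ) ≥ n, this proves (2).
-- For (3), a closed walk e₁ e₂ … of length ℓ in L(D) passes from eᵢ to eᵢ₊₁
-- through a common vertex vᵢ of D; the vertices vᵢ and vᵢ₊₁ are the two ends of
-- eᵢ₊₁ when the steps before and after eᵢ₊₁ have the same direction, and
-- coincide otherwise.  Hence the vᵢ form a closed walk whose length is ℓ minus
-- the number of changes of direction around the walk.  This number is even, and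
-- acyclicity makes it positive, so the odd-girth grows by at least 2.

open import Data.Bool.Base using (Bool; true; false; not)
import Data.Bool.Properties as Bool
open import Data.Fin.Base using (Fin; zero; suc; funToFin; finToFun)
import Data.Fin.Properties as Fin
open import Data.List.Base using (List; []; _∷_; head; last; length; map; zip; drop)
open import Data.List.Membership.Propositional using (_∈_; _∉_; find)
import Data.List.Membership.DecPropositional as DecMembership
open import Data.List.Membership.Propositional.Properties using (∈-lookup)
open import Data.List.Membership.Setoid.Properties using (index-injective)
open import Data.List.Properties using (map-injective)
open import Data.List.Relation.Unary.All using ([]; _∷_)
import Data.List.Relation.Unary.All as All
open import Data.List.Relation.Unary.All.Properties using (¬Any⇒All¬)
open import Data.List.Relation.Unary.AllPairs using ([]; _∷_)
open import Data.List.Relation.Unary.Any using (any?; here; there; index)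
open import Data.List.Relation.Unary.Linked using (Linked; [-]; _∷_)
open import Data.List.Relation.Unary.Unique.Propositional using (Unique)
open import Data.Maybe.Base using (just)
open import Data.Nat.Base
  using (ℕ; zero; suc; _+_; _*_; _^_; _≤_; _<_; _≥_; z≤n; s≤s)
open import Data.Nat.Divisibility using (_∣_; _∤_; divides; ∣m∣n⇒∣m+n)
open import Data.Nat.GeneralisedArithmetic using (iterate)
import Data.Nat.Properties as ℕ
open import Data.Product.Base using (Σ-syntax; ∃; ∃₂; _×_; _,_; proj₁; proj₂)
open import Data.Sum.Base using (inj₁; inj₂; [_,_]′)
open import Data.Unit.Base using (tt)
open import Function.Base using (_∘_; flip; id)
open import Level using (0ℓ)
open import Relation.Binary.Core using (Rel)
open import Relation.Binary.Definitions using (DecidableEquality)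
open import Relation.Binary.PropositionalEquality
  using (_≡_; _≢_; refl; sym; trans; cong; subst; setoid; module ≡-Reasoning)
open import Relation.Nullary.Decidable
  using (Dec; yes; no; toWitness; fromWitness; _×-dec_; decidable-stable)
open import Relation.Nullary.Negation using (¬_; contradiction)
open import Defs
open _≤⁺_ using (_≤⊤⁺) renaming ([_] to ≤⇒≤⁺)

-- Walks

-- Vertices may repeat, so walks can be projected and contracted without tracking distinctness. The
-- index counts edges.
data Walk {A : Set} (R : Rel A 0ℓ) : ℕ → A → A → Set where
  ε   : ∀ {u} → Walk R 0 u u
  _◅_ : ∀ {n u v w} → R u v → Walk R n v w → Walk R (suc n) u w

infixr 5 _◅_

module _ {A : Set} {R : Rel A 0ℓ} where

  vertices : ∀ {n u v} → Walk R n u v → List A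
  vertices {u = u} ε       = u ∷ []
  vertices {u = u} (_ ◅ w) = u ∷ vertices w

  length-vertices : ∀ {n u v} (w : Walk R n u v) → length (vertices w) ≡ suc n
  length-vertices ε       = refl
  length-vertices (_ ◅ w) = cong suc (length-vertices w)

  head-vertices : ∀ {n u v} (w : Walk R n u v) → head (vertices w) ≡ just u
  head-vertices ε       = refl
  head-vertices (_ ◅ _) = refl

  last-vertices : ∀ {n u v} (w : Walk R n u v) → last (vertices w) ≡ just v
  last-vertices ε           = refl
  last-vertices (_ ◅ ε)     = refl
  last-vertices (_ ◅ r ◅ w) = last-vertices (r ◅ w)

  linked-vertices : ∀ {n u v} (w : Walk R n u v) → Linked R (vertices w)
  linked-vertices ε           = [-]
  linked-vertices (r ◅ ε)     = r ∷ [-]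
  linked-vertices (r ◅ s ◅ w) = r ∷ linked-vertices (s ◅ w)

  _▻_ : ∀ {n u v w} → Walk R n u v → R v w → Walk R (suc n) u w
  ε       ▻ s = s ◅ ε
  (r ◅ w) ▻ s = r ◅ (w ▻ s)

  linked⇒walk : ∀ {p u v} → head p ≡ just u → last p ≡ just v → Linked R p →
                ∃₂ λ n (w : Walk R n u v) → vertices w ≡ p
  linked⇒walk refl refl [-]               = 0 , ε , refl
  linked⇒walk refl e    (r ∷ rs@[-])      =
    let _ , w , eq = linked⇒walk refl e rs in _ , r ◅ w , cong (_ ∷_) eq
  linked⇒walk refl e    (r ∷ rs@(_ ∷ _))  =
    let _ , w , eq = linked⇒walk refl e rs in _ , r ◅ w , cong (_ ∷_) eq

  closedPath⇒closedWalk : ∀ {c} → IsClosedPath R c →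
                          ∃₂ λ n u → length c ≡ suc n × Walk R (suc n) u u
  closedPath⇒closedWalk (_ , _ , (h , l , linked , _) , vu) with linked⇒walk h l linked
  ... | n , w , refl = n , _ , length-vertices w , vu ◅ w

  prefix : ∀ {n u v x} (w : Walk R n u v) → x ∈ vertices w → ∃ λ m → Walk R m u x
  prefix ε       (here refl) = 0 , ε
  prefix (_ ◅ _) (here refl) = 0 , ε
  prefix (r ◅ w) (there x∈)  = let m , w′ = prefix w x∈ in suc m , r ◅ w′

  suffix : ∀ {p v x} → x ∈ p → last p ≡ just v → Linked R p → Unique p → ∃ (IsPath R x v)
  suffix (here refl) l linked       unique       = _ , refl , l , linked , unique
  suffix (there x∈)  l (_ ∷ linked) (_ ∷ unique) = suffix x∈ l linked unique

  -- Loop erasure: if `u` already lies on the path obtained from the tail, the part before it is cut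
  -- off.
  walk⇒path : DecidableEquality A → ∀ {n u v} → Walk R n u v → ∃ (IsPath R u v)
  walk⇒path _≟_ ε = _ , refl , refl , [-] , [] ∷ []
  walk⇒path _≟_ {u = u} (r ◅ w) with walk⇒path _≟_ w
  ... | p@(_ ∷ _) , refl , l , linked , unique with DecMembership._∈?_ _≟_ u p
  ...   | yes u∈p = suffix u∈p l linked unique
  ...   | no  u∉p = u ∷ p , refl , l , r ∷ linked , ¬Any⇒All¬ p u∉p ∷ unique

reverse : ∀ {A : Set} {R : Rel A 0ℓ} {n u v} → Walk R n u v → Walk (flip R) n v u
reverse ε       = ε
reverse (r ◅ w) = reverse w ▻ r

-- Acyclicity and uniqueness of directed paths in terms of walks

module _ (D : Digraph) where
  open Digraph D

  NoClosedWalk : Set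
  NoClosedWalk = ∀ {n u} → ¬ Walk Arc (suc n) u u

  UniqueWalks : Set
  UniqueWalks = ∀ {m n u v} (p : Walk Arc m u v) (q : Walk Arc n u v) → vertices p ≡ vertices q

module _ {D : Digraph} where
  open Digraph D
  open Finite finite

  acyclic⇒noClosedWalk : Acyclic D → NoClosedWalk D
  acyclic⇒noClosedWalk acyclic (uv ◅ w) =
    let p , path = walk⇒path _≟_ w in acyclic p (_ , _ , path , uv)

  noClosedWalk⇒acyclic : NoClosedWalk D → Acyclic D
  noClosedWalk⇒acyclic none c closed =
    let _ , _ , _ , w = closedPath⇒closedWalk closed in none w

  unique-vertices : NoClosedWalk D → ∀ {n u v} (w : Walk Arc n u v) → Unique (vertices w)
  unique-vertices none ε       = [] ∷ []
  unique-vertices none (r ◅ w) =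
    -- A return to `u` would close a walk.
    ¬Any⇒All¬ _ (λ u∈w → none (r ◅ proj₂ (prefix w u∈w))) ∷ unique-vertices none w

  walk-isPath : NoClosedWalk D → ∀ {n u v} (w : Walk Arc n u v) → IsPath Arc u v (vertices w)
  walk-isPath none w =
    head-vertices w , last-vertices w , linked-vertices w , unique-vertices none w

  -- Without closed walks every walk is a path, and only the empty walk returns to its start. The
  -- latter settles the case of equal ends, on which `AtMostOneDirectedPath` is silent.
  atMostOne⇒uniqueWalks : NoClosedWalk D → AtMostOneDirectedPath D → UniqueWalks D
  atMostOne⇒uniqueWalks none amo {u = u} {v} p q with u ≟ v
  ... | no u≢v = amo u≢v (walk-isPath none p) (walk-isPath none q)
  atMostOne⇒uniqueWalks none amo ε          ε          | yes refl = refl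
  atMostOne⇒uniqueWalks none amo ε          q@(_ ◅ _)  | yes refl = contradiction q none
  atMostOne⇒uniqueWalks none amo p@(_ ◅ _)  q          | yes refl = contradiction p none

  uniqueWalks⇒atMostOne : UniqueWalks D → AtMostOneDirectedPath D
  uniqueWalks⇒atMostOne unique _ (h , l , linked , _) (h′ , l′ , linked′ , _)
    with linked⇒walk h l linked | linked⇒walk h′ l′ linked′
  ... | _ , w , refl | _ , w′ , refl = unique w w′

-- Line digraphs

module _ (D : Digraph) where
  private
    module D = Digraph D
    module L = Digraph (lineDigraph D)

  source target : L.V → D.V
  source ((a , _) , _) = a
  target ((_ , b) , _) = b

  arc : (e : L.V) → D.Arc (source e) (target e)
  arc (_ , ab) = toWitness ab

  arcOf : ∀ {u v} → D.Arc u v → L.V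
  arcOf uv = _ , fromWitness uv

  line⇒base : ∀ {n e f} → Walk L.Arc n e f → Walk D.Arc (suc n) (source e) (target f)
  line⇒base {e = e} ε          = arc e ◅ ε
  line⇒base {e = e} (refl ◅ w) = arc e ◅ line⇒base w

  -- Recovers the arcs of a walk from its vertex sequence, hence undoes `line⇒base` on vertex
  -- sequences.
  consecutive : List D.V → List (D.V × D.V)
  consecutive vs = zip vs (drop 1 vs)

  consecutive-line⇒base : ∀ {n e f} (w : Walk L.Arc n e f) →
    consecutive (vertices (line⇒base w)) ≡ map proj₁ (vertices w)
  consecutive-line⇒base ε                 = refl
  consecutive-line⇒base (refl ◅ ε)        = refl
  consecutive-line⇒base (refl ◅ w@(refl ◅ _)) = cong (_ ∷_) (consecutive-line⇒base w)

  ends-injective : ∀ {e f : L.V} → proj₁ e ≡ proj₁ f → e ≡ f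
  ends-injective {ab , _} refl = cong (ab ,_) (Bool.T-irrelevant _ _)

  line-noClosedWalk : NoClosedWalk D → NoClosedWalk (lineDigraph D)
  line-noClosedWalk none (refl ◅ w) = none (line⇒base w)

  line-uniqueWalks : UniqueWalks D → UniqueWalks (lineDigraph D)
  line-uniqueWalks unique p q = map-injective ends-injective (begin
    map proj₁ (vertices p)                  ≡⟨ consecutive-line⇒base p ⟨
    consecutive (vertices (line⇒base p))    ≡⟨ cong consecutive (unique (line⇒base p) (line⇒base q)) ⟩
    consecutive (vertices (line⇒base q))    ≡⟨ consecutive-line⇒base q ⟩
    map proj₁ (vertices q)                  ∎)
    where open ≡-Reasoning

naturalOrientation : (D : Digraph) → Orientation (underlying D)
naturalOrientation D = record { Arc = Arc ; asym = asym ; Arc⇒Adj = inj₁ ; Adj⇒Arc = id }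
  where open Digraph D

L⃗^-noClosedWalk : ∀ g {D} → NoClosedWalk D → NoClosedWalk (L⃗^ g D)
L⃗^-noClosedWalk zero    none = none
L⃗^-noClosedWalk (suc g) {D} none = line-noClosedWalk (L⃗^ g D) (L⃗^-noClosedWalk g {D} none)

L⃗^-uniqueWalks : ∀ g {D} → UniqueWalks D → UniqueWalks (L⃗^ g D)
L⃗^-uniqueWalks zero    unique = unique
L⃗^-uniqueWalks (suc g) {D} unique = line-uniqueWalks (L⃗^ g D) (L⃗^-uniqueWalks g {D} unique)

-- Colourings

-- Subsets of `Fin k` become functions into `Fin 2`, which `funToFin` numbers by `Fin (2 ^ k)`.
indicator : {P : Set} → Dec P → Fin 2
indicator (yes _) = suc zero
indicator (no _)  = zero

indicator-transfer : {P Q : Set} (P? : Dec P) (Q? : Dec Q) → indicator P? ≡ indicator Q? → P → Q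
indicator-transfer _       (yes q) _ _ = q
indicator-transfer (no ¬p) (no _)  _ p = contradiction p ¬p

line-colourable : ∀ D {k} → Colourable (underlying (lineDigraph D)) k →
                  Colourable (underlying D) (2 ^ k)
line-colourable D {k} (c , proper) =
  funToFin ∘ colours , [ separates , (λ vu e → separates vu (sym e)) ]′
  where
  module D = Digraph D
  module L = Digraph (lineDigraph D)

  Leaves : D.V → Fin k → L.V → Set
  Leaves v i e = source D e ≡ v × c e ≡ i

  leaves? : ∀ v i → Dec (∃ (Leaves v i))
  leaves? v i = Finite.any-dec L.finite λ e →
    Finite._≟_ D.finite (source D e) v ×-dec c e Fin.≟ i

  colours : D.V → Fin k → Fin 2
  colours v i = indicator (leaves? v i)

  separates : ∀ {u v} → D.Arc u v → funToFin (colours u) ≢ funToFin (colours v)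
  -- The colour `i` of the arc `uv` belongs to the set at `u`. If the sets agree, some arc `f`
  -- leaving `v` also has colour `i`, although `f` follows `uv` in the line digraph.
  separates {u} {v} uv eq =
    let e              = arcOf D uv
        i              = c e
        same           = trans (sym (Fin.finToFun-funToFin (colours u) i))
                           (trans (cong (λ x → finToFun x i) eq) (Fin.finToFun-funToFin (colours v) i))
        f , f-at-v , q = indicator-transfer (leaves? u i) (leaves? v i) same (e , refl , refl)
    in proper {e} {f} (inj₁ (sym f-at-v)) (sym q)

-- The `g`-fold exponential to base 2. The power is taken inside because `L^-colourable` removes the
-- outermost line digraph first.
tower : ℕ → ℕ → ℕ
tower zero    k = k
tower (suc g) k = tower g (2 ^ k)

tower-mono-≤ : ∀ g {j k} → j ≤ k → tower g j ≤ tower g k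
tower-mono-≤ zero    j≤k = j≤k
tower-mono-≤ (suc g) j≤k = tower-mono-≤ g (ℕ.^-monoʳ-≤ 2 j≤k)

L^-colourable : ∀ g D {k} → Colourable (L^ g D) k → Colourable (underlying D) (tower g k)
L^-colourable zero    D = id
L^-colourable (suc g) D = L^-colourable g D ∘ line-colourable (L⃗^ g D)

orientation-colourable : ∀ {G} (O : Orientation G) {k} →
                         Colourable (underlying (digraph O)) k → Colourable G k
orientation-colourable O (c , proper) = c , proper ∘ Orientation.Adj⇒Arc O

-- Zykov graphs

module _ {A : Set} where

  unique⊆⇒length≤ : ∀ {xs ys : List A} → Unique xs → (∀ {x} → x ∈ xs → x ∈ ys) → length xs ≤ length ys
  unique⊆⇒length≤ unique ⊆ = Fin.injective⇒≤ {f = λ i → index (⊆ (∈-lookup i))}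
    (Unique⇒lookup-injective unique ∘ index-injective (setoid A) (⊆ (∈-lookup _)) (⊆ (∈-lookup _)))

  module _ (_≟_ : DecidableEquality A) where
    open DecMembership _≟_ using (_∈?_; _∉?_)

    pigeonhole : ∀ {xs ys : List A} → Unique xs → length ys < length xs → ∃ λ x → x ∈ xs × x ∉ ys
    pigeonhole {xs} {ys} unique shorter with any? (_∉? ys) xs
    ... | yes found = find found
    ... | no  none  = contradiction shorter (ℕ.≤⇒≯ (unique⊆⇒length≤ unique λ {x} x∈ →
      decidable-stable (x ∈? ys) (All.lookup (¬Any⇒All¬ xs none) x∈)))

module _ {C : Set} where

  Proper : (G : Graph) → (Graph.V G → C) → Set
  Proper G c = ∀ {u v} → Graph.Adj G u v → c u ≢ c v

  componentColours : ∀ Gs → (Graph.V (⨄ Gs) → C) → Tuple Gs → List C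
  componentColours []       c _       = []
  componentColours (G ∷ Gs) c (x , t) = c (inj₁ x) ∷ componentColours Gs (c ∘ inj₂) t

  ∈-componentColours : ∀ Gs c t {a} → a ∈ componentColours Gs c t → ∃ λ x → IsComponent Gs x t × a ≡ c x
  ∈-componentColours (G ∷ Gs) c (y , t) (here refl) = inj₁ y , refl , refl
  ∈-componentColours (G ∷ Gs) c (y , t) (there a∈)  =
    let x , x∈t , eq = ∈-componentColours Gs (c ∘ inj₂) t a∈ in inj₂ x , x∈t , eq

  length-componentColours : ∀ Gs c t → length (componentColours Gs c t) ≡ length Gs
  length-componentColours []       c t       = refl
  length-componentColours (G ∷ Gs) c (_ , t) = cong suc (length-componentColours Gs (c ∘ inj₂) t)

length-zykovs : ∀ n → length (zykovs n) ≡ n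
length-zykovs zero    = refl
length-zykovs (suc n) = cong suc (length-zykovs n)

length-zykovColours : ∀ {C : Set} n (c : Graph.V (⨄ (zykovs n)) → C) t →
                      length (componentColours (zykovs n) c t) ≡ n
length-zykovColours n c t = trans (length-componentColours (zykovs n) c t) (length-zykovs n)

module _ {C : Set} (_≟_ : DecidableEquality C) where

  -- The `n + 1` colours that `rainbow` finds in `Z[1+ n ]` cannot all occur among the `n` colours
  -- of a tuple over `zykovs n`, so a rainbow tuple extends by a vertex of a new colour.
  rainbowTuple : ∀ n (c : Graph.V (⨄ (zykovs n)) → C) → Proper (⨄ (zykovs n)) c →
                 ∃ λ t → Unique (componentColours (zykovs n) c t)

  -- The vertex added for a rainbow tuple is adjacent to all its components, so its colour differs
  -- from their `n` colours.
  rainbow : ∀ n (c : Graph.V Z[1+ n ] → C) → Proper Z[1+ n ] c →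
            ∃ λ as → Unique as × length as ≡ suc n × (∀ {a} → a ∈ as → ∃ λ x → a ≡ c x)

  rainbowTuple zero    c proper = tt , []
  rainbowTuple (suc n) c proper
    with t , distinct ← rainbowTuple n (c ∘ inj₂) (proper ∘ right)
       | as , unique , len , used ← rainbow n (c ∘ inj₁) (proper ∘ left)
    with pigeonhole _≟_ unique
           (ℕ.≤-reflexive (trans (cong suc (length-zykovColours n _ t)) (sym len)))
  ... | a , a∈ , a∉ with used a∈
  ...   | x , refl = (x , t) , ¬Any⇒All¬ _ a∉ ∷ distinct

  rainbow n c proper with rainbowTuple n (c ∘ inj₁) (proper ∘ old)
  ... | t , distinct =
    c (inj₂ t) ∷ old-colours , ¬Any⇒All¬ _ fresh ∷ distinct ,
    cong suc (length-zykovColours n _ t) ,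
    λ { (here refl) → inj₂ t , refl
      ; (there a∈)  → let x , _ , eq = component a∈ in inj₁ x , eq }
    where
    old-colours = componentColours (zykovs n) (c ∘ inj₁) t
    component : ∀ {a} → a ∈ old-colours → _
    component = ∈-componentColours (zykovs n) (c ∘ inj₁) t
    fresh : c (inj₂ t) ∉ old-colours
    fresh a∈ = let x , x∈t , eq = component a∈ in proper (new-old x∈t) eq

zykov-colourable⇒≤ : ∀ n {k} → Colourable Z[1+ n ] k → suc n ≤ k
zykov-colourable⇒≤ n (c , proper) with rainbow Fin._≟_ n c proper
... | as , unique , len , _ = subst (_≤ _) len (Fin.injective⇒≤ (Unique⇒lookup-injective unique))

-- Odd closed walks

module _ (D : Digraph) where
  open Digraph D
  private module L = Digraph (lineDigraph D)

  Adj : Rel V 0ℓ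
  Adj = Graph.Adj (underlying D)

  Step : Bool → Rel V 0ℓ
  Step true  = Arc
  Step false = flip Arc

  direction : ∀ {u v} → Adj u v → ∃ λ s → Step s u v
  direction (inj₁ a) = true , a
  direction (inj₂ a) = false , a

  noClosedWalk-step : NoClosedWalk D → ∀ s {n u} → ¬ Walk (Step s) (suc n) u u
  noClosedWalk-step none true  w = none w
  noClosedWalk-step none false w = none (reverse w)

  -- The ends of an arc by which a walk in the line digraph leaves and enters it when moving in
  -- direction `s`.
  exit entry : Bool → L.V → V
  exit true  = target D
  exit false = source D
  entry = exit ∘ not

  traverse : ∀ s e → Adj (entry s e) (exit s e)
  traverse true  e = inj₁ (arc D e)
  traverse false e = inj₂ (arc D e)

module _ {D : Digraph} where
  open Digraph D
  private
    L = lineDigraph D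
    module L = Digraph L

  exit≡entry : ∀ s e f → Step L s e f → exit D s e ≡ entry D s f
  exit≡entry true  _ _ eq = eq
  exit≡entry false _ _ eq = sym eq

  -- j counts the changes of direction along the walk, starting from s.
  record Contraction (s : Bool) (m : ℕ) (e f : L.V) : Set where
    constructor contraction
    field
      {n} j    : ℕ
      shorten  : m ≡ j + n
      walk     : Walk (Adj D) n (entry D s e) (entry D (iterate not s j) f)
      straight : j ≡ 0 → Walk (Step L s) m e f

  -- Think of `s` as the direction of the step into `e`. If the next step keeps it, `e` is traversed
  -- and contributes an edge. If it turns, the walk leaves `e` by the end through which it came, and
  -- `e` contributes nothing.
  contract : ∀ s {m e f} → Walk (Adj L) m e f → Contraction s m e f
  contract s ε = contraction 0 refl ε λ _ → ε
  contract s {e = e} (_◅_ {v = f} r w) with direction L {e} {f} r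
  ... | s′ , step with s′ Bool.≟ s
  ...   | yes refl with contraction j refl w′ straight ← contract s w =
    contraction j (sym (ℕ.+-suc j _))
      (subst (Adj D _) (exit≡entry s e f step) (traverse D s e) ◅ w′) (λ z → step ◅ straight z)
  ...   | no s′≢s with refl ← Bool.¬-not s′≢s
                 with contraction j refl w′ _ ← contract (not s) w =
    contraction (suc j) refl (subst (λ v → Walk (Adj D) _ v _) (sym (exit≡entry (not s) e f step)) w′) λ ()

  -- The changes around the closed walk number `i * 2`. For even `j` the walk arrives at `e` in
  -- direction `s`, and traversing `e` closes it. For odd `j` there is one more change at `e`
  -- itself, and the ends already coincide.
  close : ∀ s e j {n} → Walk (Adj D) n (exit D s e) (entry D (iterate not s j) e) →
          ∃₂ λ i ℓ → suc (j + n) ≡ i * 2 + ℓ × (i ≡ 0 → j ≡ 0) × ∃ λ u → Walk (Adj D) ℓ u u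
  close s e 0 w = 0 , _ , refl , (λ _ → refl) , _ , traverse D s e ◅ w
  close s e 1 w = 1 , _ , refl , (λ ()) , _ ,
    subst (λ t → Walk (Adj D) _ (exit D s e) (exit D t e)) (Bool.not-involutive s) w
  close s e (suc (suc j)) w
    with i , ℓ , eq , _ , closed ← close s e j
           (subst (λ t → Walk (Adj D) _ (exit D s e) (entry D (iterate not t j) e)) (Bool.not-involutive s) w)
    = suc i , ℓ , cong (2 +_) eq , (λ ()) , closed

  contract-closed : NoClosedWalk D → ∀ {m e} → Walk (Adj L) m e e → 2 ∤ m →
                    ∃ λ ℓ → 2 + ℓ ≤ m × 2 ∤ ℓ × ∃ λ u → Walk (Adj D) ℓ u u
  contract-closed none ε odd = contradiction (divides 0 refl) odd
  contract-closed none {e = e} (_◅_ {v = f} r w) odd with direction L {e} {f} r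
  ... | s , step with contraction j refl w′ straight ← contract s w
                 with close s e j (subst (λ v → Walk (Adj D) _ v _) (sym (exit≡entry s e f step)) w′)
  -- With `i` zero the direction never changes, so the walk or its reverse is a closed directed walk
  -- in the line digraph.
  ... | zero  , ℓ , eq , j≡0 , _ =
    contradiction (step ◅ straight (j≡0 refl)) (noClosedWalk-step L (line-noClosedWalk D none) s)
  ... | suc i , ℓ , eq , _ , closed =
    ℓ , subst (2 + ℓ ≤_) (sym eq) (s≤s (s≤s (ℕ.m≤n+m ℓ (i * 2)))) ,
    (λ 2∣ℓ → odd (subst (2 ∣_) (sym eq) (∣m∣n⇒∣m+n (divides (suc i) refl) 2∣ℓ))) , closed

-- The induction runs over closed walks, since contracting a cycle need not give a cycle. At level
-- zero, the absence of loops rules out length 1.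
oddClosedWalk-bound : ∀ g {D} → NoClosedWalk D → ∀ {m u} →
                      Walk (Graph.Adj (L^ g D)) m u u → 2 ∤ m → 2 * g + 3 ≤ m
oddClosedWalk-bound zero none ε odd = contradiction (divides 0 refl) odd
oddClosedWalk-bound zero {D} none (r ◅ ε) odd = contradiction r (Graph.irrefl (underlying D) refl)
oddClosedWalk-bound zero none (_ ◅ _ ◅ ε) odd = contradiction (divides 1 refl) odd
oddClosedWalk-bound zero none (_ ◅ _ ◅ _ ◅ _) odd = s≤s (s≤s (s≤s z≤n))
oddClosedWalk-bound (suc g) {D} none w odd
  with ℓ , 2+ℓ≤m , odd′ , _ , w′ ← contract-closed {L⃗^ g D} (L⃗^-noClosedWalk g {D} none) w odd =
  ℕ.≤-trans (ℕ.≤-reflexive (cong (_+ 3) (ℕ.*-suc 2 g)))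
    (ℕ.≤-trans (s≤s (s≤s (oddClosedWalk-bound g {D} none w′ odd′))) 2+ℓ≤m)

oddGirth-bound : ∀ g {D} → NoClosedWalk D → [ 2 * g + 3 ] ≤⁺ oddGirth (L^ g D)
oddGirth-bound g {D} none with oddGirthExists (L^ g D)
... | ⊤⁺ , _ = _ ≤⊤⁺
... | [ _ ] , (c , ((closed , _) , odd) , refl) , _
  with n , _ , len , w ← closedPath⇒closedWalk closed =
  ≤⇒≤⁺ (subst (2 * g + 3 ≤_) (sym len) (oddClosedWalk-bound g none w (subst (2 ∤_) len odd)))

theorem20 : (g : ℕ) → g ≥ 1 →
    (Z⃗ : (n : ℕ) → Orientation Z[1+ n ]) →
    (∀ n → Acyclic (digraph (Z⃗ n))) →
    (∀ n → AtMostOneDirectedPath (digraph (Z⃗ n))) →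
    (∀ n → Σ[ O ∈ Orientation (L^ g (digraph (Z⃗ n))) ]
    (Acyclic (digraph O) × AtMostOneDirectedPath (digraph O)))
    × TendsToInfinity (λ n → χ (L^ g (digraph (Z⃗ n))))
    × (∀ n → [ 2 * g + 3 ] ≤⁺ oddGirth (L^ g (digraph (Z⃗ n))))
theorem20 g _ Z⃗ acyclic amo = orientable , unbounded , λ n → oddGirth-bound g (none n)
  where
  D : ℕ → Digraph
  D n = digraph (Z⃗ n)

  none : ∀ n → NoClosedWalk (D n)
  none n = acyclic⇒noClosedWalk {D n} (acyclic n)

  orientable : ∀ n → Σ[ O ∈ Orientation (L^ g (D n)) ]
    (Acyclic (digraph O) × AtMostOneDirectedPath (digraph O))
  -- `digraph O` has by definition the vertices and arcs of `L⃗^ g (D n)`, so statements about walks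
  -- carry over.
  orientable n = O ,
    noClosedWalk⇒acyclic {digraph O} (L⃗^-noClosedWalk g {D n} (none n)) ,
    uniqueWalks⇒atMostOne {digraph O} (L⃗^-uniqueWalks g {D n} (atMostOne⇒uniqueWalks {D n} (none n) (amo n)))
    where O = naturalOrientation (L⃗^ g (D n))

  tower-bound : ∀ n → suc n ≤ tower g (χ (L^ g (D n)))
  tower-bound n = zykov-colourable⇒≤ n (orientation-colourable (Z⃗ n)
    (L^-colourable g (D n) (proj₁ (proj₂ (chromaticNumber (L^ g (D n)))))))

  unbounded : TendsToInfinity (λ n → χ (L^ g (D n)))
  -- If `χ < k`, then `n + 1` is at most `tower g χ`, hence at most `tower g k`, which is at most
  -- `n`.
  unbounded k = tower g k , λ n n≥N → ℕ.≮⇒≥ λ χ<k →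
    ℕ.<-irrefl refl (ℕ.≤-trans (tower-bound n) (ℕ.≤-trans (tower-mono-≤ g (ℕ.<⇒≤ χ<k)) n≥N))
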